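{- The following equalities of classes hold: $$\mathbb{K}_{\mathbf{mbCciw}}=\{\mathcal{B}\in\mathbb{K}_{\mathbf{mbC}} : \mathcal{M}(\mathcal{B})\text{ validates }(\mathbf{ciw})\}=\{\mathcal{B}\in\mathbb{K}_{\mathbf{CPL}^+_{\mathbf e}} : \mathcal{M}(\mathcal{B})\text{ validates }(\mathbf{Ax10}),(\mathbf{bc1})\text{ and }(\mathbf{ciw})\}.$$
   Context: Let $\Sigma=\{\wedge,\vee,\to,\neg,\circ\}$ ($\neg,\circ$ unary, the others binary); $For(\Sigma)$ is the set of formulas over $\Sigma$ generated by a denumerable set of propositional variables. A multialgebra over $\Sigma$ is a nonempty set with operations whose values are nonempty subsets. For a Boolean algebra $\mathcal{A}$ with domain $A$ (the one-element Boolean algebra is allowed) and $z\in A^3$ write $z=(z_1,z_2,z_3)$. A swap structure for $\mathbf{CPL}^+_{\mathbf e}$ over $\mathcal{A}$ is a multialgebra $\mathcal{B}$ over $\Sigma$ with domain $|\mathcal{B}|=B\subseteq A^3$ such that $0\in\{z_1:z\in B\}$ and for all $z,w\in B$: $\emptyset\ne z\#w\subseteq\{u\in B: u_1=z_1\# w_1\}$ for $\#\in\{\wedge,\vee,\to\}$; $\emptyset\neq\neg z\subseteq\{u\in B:u_1=z_2\}$; $\emptyset\ne\circ z\subseteq\{u\in B:u_1=z_3\}$. $\mathbb{K}_{\mathbf{CPL}^+_{\mathbf e}}$ is the class of all of these, over arbitrary Boolean algebras. $\mathbb{K}_{\mathbf{mbC}}$ consists of those with $B\subseteq\{z\in A^3: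 z_1\vee z_2=1,\ z_1\wedge z_2\wedge z_3=0\}$, and $\mathbb{K}_{\mathbf{mbCciw}}$ of those in $\mathbb{K}_{\mathbf{mbC}}$ for which in addition $z_3\vee(z_1\wedge z_2)=1$ for all $z\in B$. $\mathcal{M}(\mathcal{B})=(\mathcal{B},D_{\mathcal{B}})$ is the Nmatrix with designated set $D_{\mathcal{B}}=\{z\in B: z_1=1\}$. A valuation over $\mathcal{M}(\mathcal{B})$ is $v:For(\Sigma)\to B$ with $v(\alpha\#\beta)\in v(\alpha)\#v(\beta)$, $v(\neg\alpha)\in\neg v(\alpha)$, $v(\circ\alpha)\in\circ v(\alpha)$. $\mathcal{M}(\mathcal{B})$ validates an axiom schema if $v(\gamma)\in D_{\mathcal{B}}$ for every instance $\gamma$ and every valuation $v$. The schemas are: $(\mathbf{Ax10})$ $\alpha\vee\neg\alpha$; $(\mathbf{bc1})$ $\circ\alpha\to(\alpha\to(\neg\alpha\to\beta))$; $(\mathbf{ciw})$ $\circ\alpha\vee(\alpha\wedge\neg\alpha)$. -}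

module Defs where

open import Algebra.Lattice.Bundles using (BooleanAlgebra)
open import Data.Nat.Base using (ℕ)
open import Data.Product.Base using (Σ; _×_; _,_; proj₁; proj₂; ∃-syntax)
open import Data.Product.Relation.Binary.Pointwise.NonDependent using (×-setoid)
open import Level using (Level; 0ℓ; _⊔_; suc)
open import Relation.Binary.Bundles using (Setoid)
open import Relation.Binary.Definitions using (_Respects_)
import Relation.Binary.Construct.On as On
open import Relation.Binary.PropositionalEquality.Core using (_≡_)
open import Relation.Unary using (Pred; _∈_; _⊆_; Satisfiable)

private
  variable
    a c ℓ p m d : Level

data Unary : Set where
  neg circ : Unary

data Binary : Set where
  and or imp : Binary

data Formula : Set where
  var : ℕ → Formula
  un  : Unary → Formula → Formula
  bin : Binary → Formula → Formula → Formula

infix  9 ¬ᶠ_ ∘ᶠ_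
infixr 7 _∧ᶠ_
infixr 6 _∨ᶠ_
infixr 5 _→ᶠ_

pattern ¬ᶠ_ α     = un neg α
pattern ∘ᶠ_ α     = un circ α
pattern _∧ᶠ_ α β  = bin and α β
pattern _∨ᶠ_ α β  = bin or α β
pattern _→ᶠ_ α β  = bin imp α β

-- A schema is identified with the set of its instances.
Schema : Set₁
Schema = Pred Formula 0ℓ

Ax10 : Schema
Ax10 γ = ∃[ α ] γ ≡ α ∨ᶠ ¬ᶠ α

bc1 : Schema
bc1 γ = ∃[ α ] ∃[ β ] γ ≡ ∘ᶠ α →ᶠ (α →ᶠ (¬ᶠ α →ᶠ β))

ciw : Schema
ciw γ = ∃[ α ] γ ≡ ∘ᶠ α ∨ᶠ (α ∧ᶠ ¬ᶠ α)

-- Domains are setoids, so subsets and multioperations must respect the setoid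
-- equality in every argument.
record Multialgebra (S : Setoid a ℓ) (m : Level) : Set (a ⊔ ℓ ⊔ suc m) where
  open Setoid S
  field
    element : Carrier

    un⟦_⟧  : Unary → Carrier → Pred Carrier m
    bin⟦_⟧ : Binary → Carrier → Carrier → Pred Carrier m

    un-cong  : ∀ o {x x′ u u′} → x ≈ x′ → u ≈ u′ →
               u ∈ un⟦ o ⟧ x → u′ ∈ un⟦ o ⟧ x′
    bin-cong : ∀ o {x x′ y y′ u u′} → x ≈ x′ → y ≈ y′ → u ≈ u′ →
               u ∈ bin⟦ o ⟧ x y → u′ ∈ bin⟦ o ⟧ x′ y′

    un-nonempty  : ∀ o x → Satisfiable (un⟦ o ⟧ x)
    bin-nonempty : ∀ o x y → Satisfiable (bin⟦ o ⟧ x y)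

record Nmatrix (S : Setoid a ℓ) (m d : Level) : Set (a ⊔ ℓ ⊔ suc (m ⊔ d)) where
  field
    multialgebra   : Multialgebra S m
    Designated     : Pred (Setoid.Carrier S) d
    designatedResp : Designated Respects (Setoid._≈_ S)
  open Multialgebra multialgebra public

module _ {S : Setoid a ℓ} (M : Nmatrix S m d) where
  open Setoid S using (Carrier)
  open Nmatrix M

  record IsValuation (v : Formula → Carrier) : Set (a ⊔ m) where
    field
      v-un  : ∀ o α → v (un o α) ∈ un⟦ o ⟧ (v α)
      v-bin : ∀ o α β → v (bin o α β) ∈ bin⟦ o ⟧ (v α) (v β)

  Validates : Schema → Set (a ⊔ m ⊔ d)
  Validates X = ∀ γ → γ ∈ X → ∀ v → IsValuation v → v γ ∈ Designated

module _ (𝒜 : BooleanAlgebra c ℓ) where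
  open BooleanAlgebra 𝒜

  tripleSetoid : Setoid c ℓ
  tripleSetoid = ×-setoid setoid (×-setoid setoid setoid)

  Triple : Set c
  Triple = Setoid.Carrier tripleSetoid

  subsetSetoid : Pred Triple p → Setoid (c ⊔ p) ℓ
  subsetSetoid B = On.setoid {B = Σ Triple B} tripleSetoid proj₁

  binaryOp : Binary → Carrier → Carrier → Carrier
  binaryOp and x y = x ∧ y
  binaryOp or  x y = x ∨ y
  binaryOp imp x y = ¬ x ∨ y

-- A Boolean algebra 𝒜 with a multialgebra whose domain is a subset B of A³, not
-- yet subject to any swap-structure condition.
record TripleMultialgebra (c ℓ p m : Level) : Set (suc (c ⊔ ℓ ⊔ p ⊔ m)) where
  field
    𝒜            : BooleanAlgebra c ℓ
    B            : Pred (Triple 𝒜) p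
    B-resp       : B Respects (Setoid._≈_ (tripleSetoid 𝒜))
    multialgebra : Multialgebra (subsetSetoid 𝒜 B) m

  open BooleanAlgebra 𝒜 public
  open Multialgebra multialgebra public

  ∣B∣ : Set (c ⊔ p)
  ∣B∣ = Σ (Triple 𝒜) B

  π₁ π₂ π₃ : ∣B∣ → Carrier
  π₁ ((z₁ , _  , _ ) , _) = z₁
  π₂ ((_  , z₂ , _ ) , _) = z₂
  π₃ ((_  , _  , z₃) , _) = z₃

record K-CPL⁺ₑ (𝓑 : TripleMultialgebra c ℓ p m) : Set (c ⊔ ℓ ⊔ p ⊔ m) where
  open TripleMultialgebra 𝓑
  field
    has-0     : ∃[ z ] π₁ z ≈ ⊥
    bin-swap  : ∀ o z w → bin⟦ o ⟧ z w ⊆ λ u → π₁ u ≈ binaryOp 𝒜 o (π₁ z) (π₁ w)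
    neg-swap  : ∀ z → un⟦ neg ⟧ z ⊆ λ u → π₁ u ≈ π₂ z
    circ-swap : ∀ z → un⟦ circ ⟧ z ⊆ λ u → π₁ u ≈ π₃ z

K-mbC : Pred (TripleMultialgebra c ℓ p m) (c ⊔ ℓ ⊔ p ⊔ m)
K-mbC 𝓑 = K-CPL⁺ₑ 𝓑 ×
  B ⊆ λ (z₁ , z₂ , z₃) → z₁ ∨ z₂ ≈ ⊤ × z₁ ∧ z₂ ∧ z₃ ≈ ⊥
  where open TripleMultialgebra 𝓑

K-mbCciw : Pred (TripleMultialgebra c ℓ p m) (c ⊔ ℓ ⊔ p ⊔ m)
K-mbCciw 𝓑 = K-mbC 𝓑 ×
  B ⊆ λ (z₁ , z₂ , z₃) → z₃ ∨ (z₁ ∧ z₂) ≈ ⊤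
  where open TripleMultialgebra 𝓑

𝓜 : (𝓑 : TripleMultialgebra c ℓ p m) →
    Nmatrix (subsetSetoid (TripleMultialgebra.𝒜 𝓑) (TripleMultialgebra.B 𝓑)) m ℓ
𝓜 𝓑 = record
  { multialgebra   = multialgebra
  ; Designated     = λ z → π₁ z ≈ ⊤
  ; designatedResp = λ (z₁≈w₁ , _) z₁≈⊤ → trans (sym z₁≈w₁) z₁≈⊤
  }
  where open TripleMultialgebra 𝓑

{-# OPTIONS --safe #-}
-- Under any valuation the first coordinate of an instance of an axiom at α is a Boolean
-- polynomial in the coordinates of v α (and, for bc1, the first coordinate of v β), so the
-- coordinate conditions on B imply the schemas. Conversely, each z ∈ B is the value of a
-- variable under some valuation, and for bc1 a second variable can be sent to an element
-- with first coordinate ⊥; the instances at these variables give back the conditions.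
module Submission where

open import Defs
open import Algebra.Lattice.Bundles using (BooleanAlgebra)
import Algebra.Lattice.Properties.BooleanAlgebra as BooleanAlgebraProperties
open import Data.Nat.Base using (ℕ; zero; suc)
open import Data.Product.Base using (_×_; _,_; proj₁; proj₂)
open import Level using (Level)
open import Relation.Binary.PropositionalEquality.Core using (refl)
import Relation.Binary.Reasoning.Setoid as ≈-Reasoning
open import Relation.Unary using (_≐_; _∩_)

private
  variable
    c ℓ p m : Level

module _ (𝒜 : BooleanAlgebra c ℓ) where
  open BooleanAlgebra 𝒜
  open BooleanAlgebraProperties 𝒜
  open ≈-Reasoning setoid

  ¬x≈⊤⇒x≈⊥ : ∀ {x} → ¬ x ≈ ⊤ → x ≈ ⊥
  ¬x≈⊤⇒x≈⊥ {x} ¬x≈⊤ = begin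
    x      ≈⟨ ¬-involutive x ⟨
    ¬ ¬ x  ≈⟨ ¬-cong ¬x≈⊤ ⟩
    ¬ ⊤    ≈⟨ ¬⊤≈⊥ ⟩
    ⊥      ∎

  -- Currying by De Morgan: three nested antecedents amount to one negated meet. `z` is outermost on
  -- the left and last in the meet because (bc1) opens with the consistency formula, read off the
  -- third coordinate.
  nested-imp≈¬∧∨ : ∀ x y z w →
    ¬ z ∨ (¬ x ∨ (¬ y ∨ w)) ≈ ¬ (x ∧ y ∧ z) ∨ w
  nested-imp≈¬∧∨ x y z w = begin
    ¬ z ∨ (¬ x ∨ (¬ y ∨ w))  ≈⟨ ∨-congˡ (∨-assoc (¬ x) (¬ y) w) ⟨
    ¬ z ∨ ((¬ x ∨ ¬ y) ∨ w)  ≈⟨ ∨-assoc (¬ z) (¬ x ∨ ¬ y) w ⟨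
    (¬ z ∨ (¬ x ∨ ¬ y)) ∨ w  ≈⟨ ∨-congʳ (∨-comm (¬ z) (¬ x ∨ ¬ y)) ⟩
    ((¬ x ∨ ¬ y) ∨ ¬ z) ∨ w  ≈⟨ ∨-congʳ (∨-assoc (¬ x) (¬ y) (¬ z)) ⟩
    (¬ x ∨ (¬ y ∨ ¬ z)) ∨ w  ≈⟨ ∨-congʳ (∨-congˡ (deMorgan₁ y z)) ⟨
    (¬ x ∨ ¬ (y ∧ z)) ∨ w    ≈⟨ ∨-congʳ (deMorgan₁ x (y ∧ z)) ⟨
    ¬ (x ∧ y ∧ z) ∨ w        ∎

module _ (𝓑 : TripleMultialgebra c ℓ p m) where
  open TripleMultialgebra 𝓑

  -- The nonemptiness witnesses serve as choice functions, so recursion on formulas turns any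
  -- assignment of the variables into a valuation.
  extend : (ℕ → ∣B∣) → Formula → ∣B∣
  extend ρ (var n)     = ρ n
  extend ρ (un o α)    = proj₁ (un-nonempty o (extend ρ α))
  extend ρ (bin o α β) = proj₁ (bin-nonempty o (extend ρ α) (extend ρ β))

  extend-isValuation : ∀ ρ → IsValuation (𝓜 𝓑) (extend ρ)
  extend-isValuation ρ = record
    { v-un  = λ o α → proj₂ (un-nonempty o (extend ρ α))
    ; v-bin = λ o α β → proj₂ (bin-nonempty o (extend ρ α) (extend ρ β))
    }

module _ {𝓑 : TripleMultialgebra c ℓ p m} (K : K-CPL⁺ₑ 𝓑) where
  open TripleMultialgebra 𝓑 hiding (refl)
  open BooleanAlgebraProperties 𝒜
  open K-CPL⁺ₑ K

  module _ {v : Formula → ∣B∣} (v-val : IsValuation (𝓜 𝓑) v) where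
    open IsValuation v-val
    open ≈-Reasoning setoid

    π₁-bin : ∀ o α β → π₁ (v (bin o α β)) ≈ binaryOp 𝒜 o (π₁ (v α)) (π₁ (v β))
    π₁-bin o α β = bin-swap o (v α) (v β) (v-bin o α β)

    π₁-neg : ∀ α → π₁ (v (¬ᶠ α)) ≈ π₂ (v α)
    π₁-neg α = neg-swap (v α) (v-un neg α)

    π₁-circ : ∀ α → π₁ (v (∘ᶠ α)) ≈ π₃ (v α)
    π₁-circ α = circ-swap (v α) (v-un circ α)

    π₁-Ax10 : ∀ α → π₁ (v (α ∨ᶠ ¬ᶠ α)) ≈ π₁ (v α) ∨ π₂ (v α)
    π₁-Ax10 α = trans (π₁-bin or α (¬ᶠ α)) (∨-congˡ (π₁-neg α))

    π₁-bc1 : ∀ α β → π₁ (v (∘ᶠ α →ᶠ (α →ᶠ (¬ᶠ α →ᶠ β)))) ≈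
             ¬ (π₁ (v α) ∧ π₂ (v α) ∧ π₃ (v α)) ∨ π₁ (v β)
    π₁-bc1 α β = begin
      π₁ (v (∘ᶠ α →ᶠ (α →ᶠ (¬ᶠ α →ᶠ β))))
        ≈⟨ π₁-bin imp (∘ᶠ α) (α →ᶠ (¬ᶠ α →ᶠ β)) ⟩
      ¬ π₁ (v (∘ᶠ α)) ∨ π₁ (v (α →ᶠ (¬ᶠ α →ᶠ β)))
        ≈⟨ ∨-cong (¬-cong (π₁-circ α)) (π₁-bin imp α (¬ᶠ α →ᶠ β)) ⟩
      ¬ π₃ (v α) ∨ (¬ π₁ (v α) ∨ π₁ (v (¬ᶠ α →ᶠ β)))
        ≈⟨ ∨-congˡ (∨-congˡ (π₁-bin imp (¬ᶠ α) β)) ⟩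
      ¬ π₃ (v α) ∨ (¬ π₁ (v α) ∨ (¬ π₁ (v (¬ᶠ α)) ∨ π₁ (v β)))
        ≈⟨ ∨-congˡ (∨-congˡ (∨-congʳ (¬-cong (π₁-neg α)))) ⟩
      ¬ π₃ (v α) ∨ (¬ π₁ (v α) ∨ (¬ π₂ (v α) ∨ π₁ (v β)))
        ≈⟨ nested-imp≈¬∧∨ 𝒜 _ _ _ _ ⟩
      ¬ (π₁ (v α) ∧ π₂ (v α) ∧ π₃ (v α)) ∨ π₁ (v β) ∎

    π₁-ciw : ∀ α → π₁ (v (∘ᶠ α ∨ᶠ (α ∧ᶠ ¬ᶠ α))) ≈ π₃ (v α) ∨ (π₁ (v α) ∧ π₂ (v α))
    π₁-ciw α = trans (π₁-bin or (∘ᶠ α) (α ∧ᶠ ¬ᶠ α))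
      (∨-cong (π₁-circ α) (trans (π₁-bin and α (¬ᶠ α)) (∧-congˡ (π₁-neg α))))

  Ax10-sound : (∀ z → π₁ z ∨ π₂ z ≈ ⊤) → Validates (𝓜 𝓑) Ax10
  Ax10-sound h _ (α , refl) v v-val = trans (π₁-Ax10 v-val α) (h (v α))

  -- The negated meet is already ⊤ and absorbs the value of `β`, whatever it is.
  bc1-sound : (∀ z → π₁ z ∧ π₂ z ∧ π₃ z ≈ ⊥) → Validates (𝓜 𝓑) bc1
  bc1-sound h _ (α , β , refl) v v-val = begin
    π₁ (v (∘ᶠ α →ᶠ (α →ᶠ (¬ᶠ α →ᶠ β))))             ≈⟨ π₁-bc1 v-val α β ⟩
    ¬ (π₁ (v α) ∧ π₂ (v α) ∧ π₃ (v α)) ∨ π₁ (v β)   ≈⟨ ∨-congʳ (¬-cong (h (v α))) ⟩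
    ¬ ⊥ ∨ π₁ (v β)                                  ≈⟨ ∨-congʳ ¬⊥≈⊤ ⟩
    ⊤ ∨ π₁ (v β)                                    ≈⟨ ∨-zeroˡ _ ⟩
    ⊤                                               ∎
    where open ≈-Reasoning setoid

  ciw-sound : (∀ z → π₃ z ∨ (π₁ z ∧ π₂ z) ≈ ⊤) → Validates (𝓜 𝓑) ciw
  ciw-sound h _ (α , refl) v v-val = trans (π₁-ciw v-val α) (h (v α))

  private
    -- `var 0` carries the element under test; `var 1`, which plays `β` in (bc1), gets an element
    -- with first coordinate ⊥.
    assign : ∣B∣ → ℕ → ∣B∣
    assign z zero    = z
    assign z (suc _) = proj₁ has-0

    valuation : ∀ z → IsValuation (𝓜 𝓑) (extend 𝓑 (assign z))
    valuation z = extend-isValuation 𝓑 (assign z)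

  -- The valuation sends `var 0` to `z` by computation, so the polynomial of the instance at `var 0`
  -- is literally the required join.
  Ax10-complete : Validates (𝓜 𝓑) Ax10 → ∀ z → π₁ z ∨ π₂ z ≈ ⊤
  Ax10-complete valid z =
    trans (sym (π₁-Ax10 (valuation z) (var 0))) (valid _ (var 0 , refl) _ (valuation z))

  -- With the consequent `var 1` worth ⊥, the value of the instance collapses to the negated meet,
  -- which validity makes ⊤.
  bc1-complete : Validates (𝓜 𝓑) bc1 → ∀ z → π₁ z ∧ π₂ z ∧ π₃ z ≈ ⊥
  bc1-complete valid z = ¬x≈⊤⇒x≈⊥ 𝒜 (begin
    ¬ (π₁ z ∧ π₂ z ∧ π₃ z)                      ≈⟨ ∨-identityʳ _ ⟨
    ¬ (π₁ z ∧ π₂ z ∧ π₃ z) ∨ ⊥                  ≈⟨ ∨-congˡ (proj₂ has-0) ⟨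
    ¬ (π₁ z ∧ π₂ z ∧ π₃ z) ∨ π₁ (proj₁ has-0)   ≈⟨ π₁-bc1 (valuation z) (var 0) (var 1) ⟨
    _                                           ≈⟨ valid _ (var 0 , var 1 , refl) _ (valuation z) ⟩
    ⊤                                           ∎)
    where open ≈-Reasoning setoid

  ciw-complete : Validates (𝓜 𝓑) ciw → ∀ z → π₃ z ∨ (π₁ z ∧ π₂ z) ≈ ⊤
  ciw-complete valid z =
    trans (sym (π₁-ciw (valuation z) (var 0))) (valid _ (var 0 , refl) _ (valuation z))

proposition8p4 : ∀ {c ℓ p m : Level} →
    (K-mbCciw {c} {ℓ} {p} {m} ≐ (K-mbC ∩ λ 𝓑 → Validates (𝓜 𝓑) ciw))
    ×
    ((K-mbC {c} {ℓ} {p} {m} ∩ λ 𝓑 → Validates (𝓜 𝓑) ciw) ≐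
    (K-CPL⁺ₑ ∩ λ 𝓑 →
    Validates (𝓜 𝓑) Ax10 × Validates (𝓜 𝓑) bc1 × Validates (𝓜 𝓑) ciw))
proposition8p4 =
  -- The classes state their conditions as inclusions of `B`, the lemmas as statements over `∣B∣`;
  -- pairing a triple with its membership proof passes between the two.
  ( (λ ((K , mbC) , B⊆) → (K , mbC) , ciw-sound K (λ (_ , z∈B) → B⊆ z∈B))
  , (λ ((K , mbC) , valid) → (K , mbC) , λ z∈B → ciw-complete K valid (_ , z∈B)))
  ,
  -- Here (ciw) is carried along unchanged: the two conditions of `K-mbC` are traded for (Ax10) and
  -- (bc1) respectively.
  ( (λ ((K , mbC) , valid) →
      K , Ax10-sound K (λ (_ , z∈B) → proj₁ (mbC z∈B))
        , bc1-sound K (λ (_ , z∈B) → proj₂ (mbC z∈B))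
        , valid)
  , (λ (K , ax10 , bc , valid) →
      (K , λ z∈B → Ax10-complete K ax10 (_ , z∈B) , bc1-complete K bc (_ , z∈B))
      , valid))
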